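{- For any tree $T$ of order $n\geq 5$, we have $\text{max-sep}_{RB}(T)\leq\frac{n+s(T)}{2}$, where $s(T)$ is the number of support vertices of $T$.
   Context: A leaf of a tree is a vertex of degree $1$; a support vertex is a vertex adjacent to at least one leaf; $s(T)$ is the number of support vertices of $T$. $N[x]$ denotes the closed neighborhood of $x$. A red-blue coloring of a graph $G$ is a map $c:V(G)\to\{\text{red},\text{blue}\}$. A red-blue separating set of $(G,c)$ is a set $S\subseteq V(G)$ such that $N[r]\cap S\neq N[b]\cap S$ for every red vertex $r$ and every blue vertex $b$. For a twin-free graph $G$ (no two distinct vertices have the same closed neighborhood; this holds for every tree on at least $3$ vertices), $\mathrm{sep}_{RB}(G,c)$ is the smallest size of a red-blue separating set of $(G,c)$, and $\text{max-sep}_{RB}(G)$ is the maximum of $\mathrm{sep}_{RB}(G,c)$ over all red-blue colorings $c$ of $G$. -}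

module Defs where

open import Data.Bool.Properties using () renaming (_≟_ to _≟ᵇ_)
open import Data.Fin.Base using (Fin)
open import Data.Fin.Properties using (any?; all?)
open import Data.Fin.Subset using (Subset; inside; outside; ⊤; ⁅_⁆; _∪_; _∩_; ∣_∣)
open import Data.Fin.Subset.Properties using (∩-identityʳ; ∣⊤∣≡n)
open import Data.List.Base using (List; []; _∷_; _∷ʳ_; length; map; filter; cartesianProductWith)
open import Data.List.Extrema.Nat using (min; max; argmin-sel; argmax-sel; min≤xs; xs≤max)
open import Data.List.Membership.Propositional using (_∈_)
open import Data.List.Membership.Propositional.Properties
  using (∈-map⁺; ∈-map⁻; ∈-filter⁺; ∈-filter⁻; ∈-cartesianProductWith⁺)
open import Data.List.Properties using (filter-≐)
open import Data.List.Relation.Unary.All as All using ()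
open import Data.List.Relation.Unary.Any using (here; there)
open import Data.List.Relation.Unary.Linked using (Linked)
open import Data.List.Relation.Unary.Unique.Propositional using (Unique)
open import Data.Nat.Base using (ℕ; zero; suc; _≤_; z≤n)
open import Data.Nat.Properties using (≤-antisym) renaming (_≟_ to _≟ⁿ_)
open import Data.Product.Base using (_×_; _,_; proj₂; ∃-syntax)
open import Data.Sum.Base using (inj₁; inj₂)
open import Data.Vec.Base using (Vec; []; _∷_; lookup; tabulate)
open import Data.Vec.Properties using (≡-dec; lookup∘tabulate)
open import Function.Base using (id)
open import Level using (0ℓ)
open import Relation.Binary.Construct.Closure.ReflexiveTransitive using (Star)
open import Relation.Binary.Core using (Rel)
open import Relation.Binary.Definitions using (Decidable; DecidableEquality; Symmetric; Irreflexive)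
open import Relation.Binary.PropositionalEquality
  using (_≡_; _≢_; refl; sym; trans; cong; subst)
open import Relation.Nullary.Decidable using (yes; no; does; _×-dec_; _→-dec_; ¬?)
open import Relation.Nullary.Negation.Core using (¬_; contradiction)
import Relation.Unary as U

record Graph (n : ℕ) : Set₁ where
  infix 4 _~_ _~?_
  field
    _~_      : Rel (Fin n) 0ℓ
    _~?_     : Decidable _~_
    ~-sym    : Symmetric _~_
    ~-irrefl : Irreflexive _≡_ _~_

data Colour : Set where
  red blue : Colour

_≟ᶜ_ : DecidableEquality Colour
red  ≟ᶜ red  = yes refl
red  ≟ᶜ blue = no λ ()
blue ≟ᶜ red  = no λ ()
blue ≟ᶜ blue = yes refl

Colouring : ℕ → Set
Colouring n = Fin n → Colour

⟪_⟫ : ∀ {n} {P : Fin n → Set} → U.Decidable P → Subset n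
⟪ P? ⟫ = tabulate (λ x → does (P? x))

allVecs : ∀ {A : Set} → List A → (n : ℕ) → List (Vec A n)
allVecs xs zero    = [] ∷ []
allVecs xs (suc n) = cartesianProductWith _∷_ xs (allVecs xs n)

allSubsets : ∀ n → List (Subset n)
allSubsets = allVecs (outside ∷ inside ∷ [])

-- Every colouring is pointwise equal to a member of this list.
allColourings : ∀ n → List (Colouring n)
allColourings n = map lookup (allVecs (red ∷ blue ∷ []) n)

module _ {n : ℕ} (G : Graph n) where
  open Graph G

  Connected : Set
  Connected = ∀ u v → Star _~_ u v

  -- A cycle start, rest₁, …, restₖ, start with k + 1 ≥ 3 distinct vertices.
  record Cycle : Set where
    field
      start    : Fin n
      rest     : List (Fin n)
      closed   : Linked _~_ (start ∷ (rest ∷ʳ start))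
      distinct : Unique (start ∷ rest)
      long     : 2 ≤ length rest

  record IsTree : Set where
    field
      connected : Connected
      acyclic   : ¬ Cycle

  N⟨_⟩ : Fin n → Subset n
  N⟨ x ⟩ = ⟪ x ~?_ ⟫

  N[_] : Fin n → Subset n
  N[ x ] = ⁅ x ⁆ ∪ N⟨ x ⟩

  TwinFree : Set
  TwinFree = ∀ {u v} → N[ u ] ≡ N[ v ] → u ≡ v

  degree : Fin n → ℕ
  degree x = ∣ N⟨ x ⟩ ∣

  Leaf : Fin n → Set
  Leaf x = degree x ≡ 1

  leaf? : U.Decidable Leaf
  leaf? x = degree x ≟ⁿ 1

  Support : Fin n → Set
  Support x = ∃[ y ] x ~ y × Leaf y

  support? : U.Decidable Support
  support? x = any? λ y → (x ~? y) ×-dec leaf? y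

  s : ℕ
  s = ∣ ⟪ support? ⟫ ∣

  Separating : Colouring n → Subset n → Set
  Separating c S = ∀ r b → c r ≡ red → c b ≡ blue → N[ r ] ∩ S ≢ N[ b ] ∩ S

  separating? : ∀ c → U.Decidable (Separating c)
  separating? c S = all? λ r → all? λ b →
    (c r ≟ᶜ red) →-dec ((c b ≟ᶜ blue) →-dec ¬? (≡-dec _≟ᵇ_ (N[ r ] ∩ S) (N[ b ] ∩ S)))

  -- The minimum includes the default value n, the size of the whole vertex
  -- set. The vertex set is separating when G is twin-free, so then this is
  -- the true minimum (sepRB-minimal, sepRB-attained); without
  -- twin-freeness there may be no separating set at all.
  sepRB : Colouring n → ℕ
  sepRB c = min n (map ∣_∣ (filter (separating? c) (allSubsets n)))

  maxSepRB : ℕ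
  maxSepRB = max 0 (map sepRB (allColourings n))

∈-allVecs : ∀ {A : Set} {xs : List A} → (∀ x → x ∈ xs) → ∀ {n} (v : Vec A n) → v ∈ allVecs xs n
∈-allVecs ∈xs []      = here refl
∈-allVecs ∈xs (x ∷ v) = ∈-cartesianProductWith⁺ _∷_ (∈xs x) (∈-allVecs ∈xs v)

∈-allSubsets : ∀ {n} (S : Subset n) → S ∈ allSubsets n
∈-allSubsets = ∈-allVecs λ where
  outside → here refl
  inside  → there (here refl)

module _ {n : ℕ} (G : Graph n) where

  ⊤-separating : TwinFree G → ∀ c → Separating G c ⊤
  ⊤-separating twinFree c r b cr cb eq
    with refl ← twinFree {r} {b} (trans (sym (∩-identityʳ _)) (trans eq (∩-identityʳ _)))
    with () ← trans (sym cr) cb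

  sepRB-minimal : ∀ c S → Separating G c S → sepRB G c ≤ ∣ S ∣
  sepRB-minimal c S sep =
    All.lookup (min≤xs n _) (∈-map⁺ ∣_∣ (∈-filter⁺ (separating? G c) (∈-allSubsets S) sep))

  sepRB-attained : TwinFree G → ∀ c → ∃[ S ] Separating G c S × ∣ S ∣ ≡ sepRB G c
  sepRB-attained twinFree c
    with argmin-sel id n (map ∣_∣ (filter (separating? G c) (allSubsets n)))
  ... | inj₁ eq = ⊤ , ⊤-separating twinFree c , trans (∣⊤∣≡n n) (sym eq)
  ... | inj₂ mem with S , S∈ , eq ← ∈-map⁻ ∣_∣ mem =
    S , proj₂ (∈-filter⁻ (separating? G c) {xs = allSubsets n} S∈) , sym eq

  sepRB-cong : ∀ {c d} → (∀ x → c x ≡ d x) → sepRB G c ≡ sepRB G d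
  sepRB-cong {c} {d} c≗d = cong (λ xs → min n (map ∣_∣ xs))
    (filter-≐ (separating? G c) (separating? G d)
      ( (λ sep r b dr db → sep r b (trans (c≗d r) dr) (trans (c≗d b) db))
      , (λ sep r b cr cb → sep r b (trans (sym (c≗d r)) cr) (trans (sym (c≗d b)) cb)))
      (allSubsets n))

  maxSepRB-maximal : ∀ c → sepRB G c ≤ maxSepRB G
  maxSepRB-maximal c = subst (_≤ maxSepRB G) (sepRB-cong (lookup∘tabulate c))
    (All.lookup (xs≤max 0 _) (∈-map⁺ (sepRB G) (∈-map⁺ lookup (∈-allVecs ∈colours (tabulate c)))))
    where
    ∈colours : ∀ k → k ∈ red ∷ blue ∷ []
    ∈colours red  = here refl
    ∈colours blue = there (here refl)

  maxSepRB-attained : ∃[ c ] sepRB G c ≡ maxSepRB G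
  maxSepRB-attained with argmax-sel id 0 (map (sepRB G) (allColourings n))
  ... | inj₁ eq = (λ _ → red) ,
    ≤-antisym (maxSepRB-maximal _) (subst (_≤ sepRB G (λ _ → red)) (sym eq) z≤n)
  ... | inj₂ mem with c , _ , eq ← ∈-map⁻ (sepRB G) mem = c , sym eq

{-# OPTIONS --safe #-}

-- Fix a colouring and a proper 2-colouring π of the tree. When every support
-- vertex has a non-leaf neighbour, there is a partition of the vertices into
-- two classes A₀, A₁ and a set E of at most s(T) anchors such that A₀ ∪ E and
-- A₁ ∪ E are both separating; their sizes sum to n + ∣E∣, so one of them is
-- small enough. The partition is given by π, except that a leaf is moved to
-- the class of its support u when u is mixed (u has leaves of both colours)
-- and the leaf has the colour of u. The anchor of a mixed support is the
-- support itself; the anchor of any other support is a non-leaf neighbour.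
-- The remaining trees are stars. There the partition into colour classes works
-- with one leaf of the centre's colour as anchor, and if no leaf has the
-- centre's colour then any two leaves separate.

module Submission where

open import Defs
open import Data.Bool.Base using (Bool; true; false; not; _xor_; if_then_else_)
open import Data.Bool.Properties using (not-¬; ¬-not; not-involutive; not-distribˡ-xor)
  renaming (_≟_ to _≟ᵇ_)
open import Data.Fin.Base using (Fin; zero; suc)
open import Data.Fin.Properties using (any?; _≟_)
open import Data.Fin.Subset using (Subset; inside; outside; ⊤; ⊥; ∁; ⁅_⁆; _∪_; _∩_; ∣_∣; _∈_; _⊆_)
open import Data.Fin.Subset.Properties
  using (∣⊤∣≡n; ∣⊥∣≡0; x∈⁅x⁆; x∈⁅y⁆⇒x≡y; ∣⁅x⁆∣≡1; ⊆-antisym; p⊆q⇒∣p∣≤∣q∣; x∈p∪q⁺; x∈p∪q⁻;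
         x∈p∩q⁺; x∈p∩q⁻; x∈p∧x≢y⇒x∈p-y; x∈p⇒∣p-x∣<∣p∣)
open import Data.List.Base using (List; []; _∷_; _∷ʳ_; _++_; length)
import Data.List.Membership.DecPropositional as DecMembership
open import Data.List.Membership.Propositional.Properties using (∈-∃++)
open import Data.List.Properties using (length-++)
open import Data.List.Relation.Unary.All using ([]; _∷_)
open import Data.List.Relation.Unary.All.Properties using (¬Any⇒All¬)
open import Data.List.Relation.Unary.AllPairs using ([]; _∷_)
open import Data.List.Relation.Unary.Linked using (Linked; [-]; _∷_)
open import Data.List.Relation.Unary.Unique.Propositional using (Unique)
open import Data.Nat.Base using (ℕ; zero; suc; _+_; _*_; _≤_; _<_; z≤n; s≤s)
open import Data.Nat.Properties
  using (≤-refl; ≤-trans; ≤-reflexive; ≤-pred; +-mono-≤; +-monoʳ-≤; +-suc; +-identityʳ; *-monoʳ-≤;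
         m≤n⇒m≤1+n; 1+n≰n; m≤m+n; m≤n+m; module ≤-Reasoning)
open import Data.Product.Base using (_×_; _,_; proj₁; proj₂; ∃-syntax)
open import Data.Sum.Base using (_⊎_; inj₁; inj₂)
open import Data.Vec.Base using ([]; _∷_; tabulate; here; there)
open import Data.Vec.Properties using (lookup∘tabulate; lookup⇒[]=; []=⇒lookup; lookup-map)
open import Function.Base using (_∘_)
open import Relation.Binary.Construct.Closure.ReflexiveTransitive using (Star; ε; _◅_)
open import Relation.Binary.PropositionalEquality
  using (_≡_; _≢_; refl; sym; trans; cong; cong₂; subst)
open import Relation.Nullary.Decidable
  using (yes; no; does; _×-dec_; ¬?; dec-true; dec-false; decidable-stable)
open import Relation.Nullary.Negation.Core using (¬_; contradiction)
import Relation.Unary as U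

private variable
  m n : ℕ

-- Subsets

∣p∪q∣≤∣p∣+∣q∣ : ∀ (p q : Subset n) → ∣ p ∪ q ∣ ≤ ∣ p ∣ + ∣ q ∣
∣p∪q∣≤∣p∣+∣q∣ []            []            = z≤n
∣p∪q∣≤∣p∣+∣q∣ (outside ∷ p) (outside ∷ q) = ∣p∪q∣≤∣p∣+∣q∣ p q
∣p∪q∣≤∣p∣+∣q∣ (outside ∷ p) (inside  ∷ q) =
  ≤-trans (s≤s (∣p∪q∣≤∣p∣+∣q∣ p q)) (≤-reflexive (sym (+-suc ∣ p ∣ ∣ q ∣)))
∣p∪q∣≤∣p∣+∣q∣ (inside  ∷ p) (outside ∷ q) = s≤s (∣p∪q∣≤∣p∣+∣q∣ p q)
∣p∪q∣≤∣p∣+∣q∣ (inside  ∷ p) (inside  ∷ q) =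
  s≤s (≤-trans (∣p∪q∣≤∣p∣+∣q∣ p q) (+-monoʳ-≤ ∣ p ∣ (m≤n⇒m≤1+n ≤-refl)))

-- A point outside `q` lies in exactly one of the two unions, a point of `q` in both.
∣p∪q∣+∣∁p∪q∣≡n+∣q∣ : ∀ (p q : Subset n) → ∣ p ∪ q ∣ + ∣ ∁ p ∪ q ∣ ≡ n + ∣ q ∣
∣p∪q∣+∣∁p∪q∣≡n+∣q∣ []            []            = refl
∣p∪q∣+∣∁p∪q∣≡n+∣q∣ (outside ∷ p) (outside ∷ q) = trans (+-suc _ _) (cong suc (∣p∪q∣+∣∁p∪q∣≡n+∣q∣ p q))
∣p∪q∣+∣∁p∪q∣≡n+∣q∣ (inside  ∷ p) (outside ∷ q) = cong suc (∣p∪q∣+∣∁p∪q∣≡n+∣q∣ p q)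
∣p∪q∣+∣∁p∪q∣≡n+∣q∣ (outside ∷ p) (inside  ∷ q) =
  cong suc (trans (+-suc _ _) (trans (cong suc (∣p∪q∣+∣∁p∪q∣≡n+∣q∣ p q)) (sym (+-suc _ _))))
∣p∪q∣+∣∁p∪q∣≡n+∣q∣ (inside  ∷ p) (inside  ∷ q) =
  cong suc (trans (+-suc _ _) (trans (cong suc (∣p∪q∣+∣∁p∪q∣≡n+∣q∣ p q)) (sym (+-suc _ _))))

image : (Fin m → Fin n) → Subset m → Subset n
image f []            = ⊥
image f (outside ∷ p) = image (f ∘ suc) p
image f (inside  ∷ p) = ⁅ f zero ⁆ ∪ image (f ∘ suc) p

∈-image⁺ : ∀ (f : Fin m → Fin n) {p x} → x ∈ p → f x ∈ image f p
∈-image⁺ f {inside  ∷ p} here        = x∈p∪q⁺ (inj₁ (x∈⁅x⁆ _))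
∈-image⁺ f {inside  ∷ p} (there x∈p) = x∈p∪q⁺ (inj₂ (∈-image⁺ (f ∘ suc) x∈p))
∈-image⁺ f {outside ∷ p} (there x∈p) = ∈-image⁺ (f ∘ suc) x∈p

∣image∣≤∣p∣ : ∀ (f : Fin m → Fin n) p → ∣ image f p ∣ ≤ ∣ p ∣
∣image∣≤∣p∣ {n = n} f []  = ≤-reflexive (∣⊥∣≡0 n)
∣image∣≤∣p∣ f (outside ∷ p) = ∣image∣≤∣p∣ (f ∘ suc) p
∣image∣≤∣p∣ f (inside  ∷ p) = begin
  ∣ ⁅ f zero ⁆ ∪ image (f ∘ suc) p ∣      ≤⟨ ∣p∪q∣≤∣p∣+∣q∣ ⁅ f zero ⁆ _ ⟩
  ∣ ⁅ f zero ⁆ ∣ + ∣ image (f ∘ suc) p ∣  ≤⟨ +-mono-≤ (≤-reflexive (∣⁅x⁆∣≡1 (f zero))) (∣image∣≤∣p∣ (f ∘ suc) p) ⟩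
  suc ∣ p ∣                               ∎
  where open ≤-Reasoning

x∈p⇒1≤∣p∣ : ∀ {p : Subset n} {x} → x ∈ p → 1 ≤ ∣ p ∣
x∈p⇒1≤∣p∣ {x = x} x∈p = ≤-trans (≤-reflexive (sym (∣⁅x⁆∣≡1 x)))
  (p⊆q⇒∣p∣≤∣q∣ λ y∈ → subst (_∈ _) (sym (x∈⁅y⁆⇒x≡y x y∈)) x∈p)

∣p∣≡1⇒unique : ∀ {p : Subset n} → ∣ p ∣ ≡ 1 → ∀ {x y} → x ∈ p → y ∈ p → x ≡ y
∣p∣≡1⇒unique {p = p} ∣p∣≡1 {x} {y} x∈p y∈p with x ≟ y
... | yes x≡y = x≡y
... | no  x≢y = contradiction
  (≤-trans (s≤s (x∈p⇒1≤∣p∣ (x∈p∧x≢y⇒x∈p-y x∈p x≢y))) (≤-trans (x∈p⇒∣p-x∣<∣p∣ y∈p) (≤-reflexive ∣p∣≡1)))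
  1+n≰n

fresh : 3 ≤ n → ∀ (x y : Fin n) → ∃[ z ] z ≢ x × z ≢ y
fresh {n} 3≤n x y with any? (λ z → ¬? (z ≟ x) ×-dec ¬? (z ≟ y))
... | yes found = found
... | no  none  = contradiction (≤-trans 3≤n n≤2) 1+n≰n
  where
  open ≤-Reasoning
  covers : ⊤ ⊆ ⁅ x ⁆ ∪ ⁅ y ⁆
  covers {z} _ with z ≟ x | z ≟ y
  ... | yes refl | _        = x∈p∪q⁺ (inj₁ (x∈⁅x⁆ z))
  ... | no _     | yes refl = x∈p∪q⁺ (inj₂ (x∈⁅x⁆ z))
  ... | no z≢x   | no z≢y   = contradiction (z , z≢x , z≢y) none
  n≤2 : n ≤ 2
  n≤2 = begin
    n                      ≡⟨ ∣⊤∣≡n n ⟨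
    ∣ ⊤ {n} ∣              ≤⟨ p⊆q⇒∣p∣≤∣q∣ covers ⟩
    ∣ ⁅ x ⁆ ∪ ⁅ y ⁆ ∣      ≤⟨ ∣p∪q∣≤∣p∣+∣q∣ ⁅ x ⁆ ⁅ y ⁆ ⟩
    ∣ ⁅ x ⁆ ∣ + ∣ ⁅ y ⁆ ∣  ≡⟨ cong₂ _+_ (∣⁅x⁆∣≡1 x) (∣⁅x⁆∣≡1 y) ⟩
    2                      ∎

∈-tabulate⁺ : ∀ (f : Fin n → Bool) {x} → f x ≡ true → x ∈ tabulate f
∈-tabulate⁺ f {x} eq = lookup⇒[]= x _ (trans (lookup∘tabulate f x) eq)

∈-∁tabulate⁺ : ∀ (f : Fin n → Bool) {x} → f x ≡ false → x ∈ ∁ (tabulate f)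
∈-∁tabulate⁺ f {x} eq =
  lookup⇒[]= x _ (trans (lookup-map x not (tabulate f)) (cong not (trans (lookup∘tabulate f x) eq)))

module _ {P : Fin n → Set} (P? : U.Decidable P) where

  ∈-⟪⟫⁺ : ∀ {x} → P x → x ∈ ⟪ P? ⟫
  ∈-⟪⟫⁺ {x} px = ∈-tabulate⁺ _ (dec-true (P? x) px)

  ∈-⟪⟫⁻ : ∀ {x} → x ∈ ⟪ P? ⟫ → P x
  ∈-⟪⟫⁻ {x} x∈ with P? x | trans (sym (lookup∘tabulate _ x)) ([]=⇒lookup x∈)
  ... | yes px | _ = px

≢⇒≡ᶜ : ∀ {a b d : Colour} → a ≢ d → a ≢ b → b ≡ d
≢⇒≡ᶜ {red}  {red}  a≢d a≢b = contradiction refl a≢b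
≢⇒≡ᶜ {red}  {blue} {red}  a≢d a≢b = contradiction refl a≢d
≢⇒≡ᶜ {red}  {blue} {blue} a≢d a≢b = refl
≢⇒≡ᶜ {blue} {blue} a≢d a≢b = contradiction refl a≢b
≢⇒≡ᶜ {blue} {red}  {blue} a≢d a≢b = contradiction refl a≢d
≢⇒≡ᶜ {blue} {red}  {red}  a≢d a≢b = refl

-- Walks and parity

parity : ∀ {A : Set} → List A → Bool
parity []       = false
parity (_ ∷ xs) = not (parity xs)

parity-++ : ∀ {A : Set} (xs ys : List A) → parity (xs ++ ys) ≡ parity xs xor parity ys
parity-++ []       ys = refl
parity-++ (x ∷ xs) ys = trans (cong not (parity-++ xs ys)) (not-distribˡ-xor (parity xs) (parity ys))

-- For a closed walk cut into three pieces at a repeated vertex: the middle piece is closed, the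
-- outer two join to a closed walk, and an odd total makes one of these odd.
xor-true : ∀ a b d → a xor (b xor d) ≡ true → b ≡ true ⊎ a xor d ≡ true
xor-true a true  d _  = inj₁ refl
xor-true a false d eq = inj₂ eq

unique⊎repeat : ∀ (xs : List (Fin n)) →
  Unique xs ⊎ ∃[ as ] ∃[ bs ] ∃[ cs ] ∃[ w ] xs ≡ as ++ w ∷ bs ++ w ∷ cs
unique⊎repeat []       = inj₁ []
unique⊎repeat (x ∷ xs) with DecMembership._∈?_ _≟_ x xs | unique⊎repeat xs
... | yes x∈xs | _ with bs , cs , refl ← ∈-∃++ x∈xs = inj₂ ([] , bs , cs , x , refl)
... | no  _    | inj₂ (as , bs , cs , w , refl) = inj₂ (x ∷ as , bs , cs , w , refl)
... | no  x∉xs | inj₁ unique = inj₁ (¬Any⇒All¬ xs x∉xs ∷ unique)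

module _ {n : ℕ} (G : Graph n) where
  open Graph G

  -- The list holds the vertices of the walk except the last one, so its length
  -- is the number of edges.
  data Walk : Fin n → List (Fin n) → Fin n → Set where
    nil  : ∀ {u} → Walk u [] u
    cons : ∀ {u w v xs} → u ~ w → Walk w xs v → Walk u (u ∷ xs) v

  walk-++ : ∀ {u v w xs ys} → Walk u xs v → Walk v ys w → Walk u (xs ++ ys) w
  walk-++ nil        q = q
  walk-++ (cons e p) q = cons e (walk-++ p q)

  walk-split : ∀ {u v w} as {ys} → Walk u (as ++ w ∷ ys) v → Walk u as w × Walk w (w ∷ ys) v
  walk-split []       p@(cons _ _) = nil , p
  walk-split (a ∷ as) (cons e p) with p₁ , p₂ ← walk-split as p = cons e p₁ , p₂

  walk-reverse : ∀ {u v xs} → Walk u xs v → ∃[ ys ] Walk v ys u × parity ys ≡ parity xs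
  walk-reverse nil = [] , nil , refl
  walk-reverse (cons {xs = xs} e p) with ys , q , eq ← walk-reverse p =
    ys ++ _ ∷ [] , walk-++ q (cons (~-sym e) nil) ,
    trans (parity-++ ys _) (trans (cong (_xor true) eq) (xor-trueʳ (parity xs)))
    where
    xor-trueʳ : ∀ a → a xor true ≡ not a
    xor-trueʳ true  = refl
    xor-trueʳ false = refl

  walk-linked : ∀ {u xs v} → Walk u xs v → Linked _~_ (xs ∷ʳ v)
  walk-linked nil                     = [-]
  walk-linked (cons e nil)            = e ∷ [-]
  walk-linked (cons e p@(cons _ _))   = e ∷ walk-linked p

  star⇒walk : ∀ {u v} → Star _~_ u v → ∃[ xs ] Walk u xs v
  star⇒walk ε       = [] , nil
  star⇒walk (e ◅ p) with xs , q ← star⇒walk p = _ ∷ xs , cons e q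

  -- Lengths 0 and 2 are even and length 1 would be a loop, so at least three distinct vertices
  -- remain.
  unique-odd⇒cycle : ∀ {u xs} → Walk u xs u → Unique xs → parity xs ≡ true → Cycle G
  unique-odd⇒cycle nil _ ()
  unique-odd⇒cycle (cons e nil) _ _ = contradiction e (~-irrefl refl)
  unique-odd⇒cycle (cons _ (cons _ nil)) _ ()
  unique-odd⇒cycle p@(cons _ (cons _ (cons _ _))) unique _ = record
    { closed = walk-linked p ; distinct = unique ; long = s≤s (s≤s z≤n) }

  -- A repeated vertex splits a closed walk into two shorter ones, one of which
  -- is odd.
  odd⇒cycle : ∀ k {u xs} → length xs ≤ k → Walk u xs u → parity xs ≡ true → Cycle G
  odd⇒cycle zero    {xs = []} _ nil ()
  odd⇒cycle (suc k) {xs = xs} ≤k p odd with unique⊎repeat xs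
  ... | inj₁ unique = unique-odd⇒cycle p unique odd
  ... | inj₂ (as , bs , cs , w , refl)
    with p₁ , p₂₃ ← walk-split as p
    with p₂ , p₃ ← walk-split (w ∷ bs) p₂₃
    with xor-true (parity as) (parity (w ∷ bs)) (parity (w ∷ cs))
           (trans (sym (trans (parity-++ as _)
             (cong (parity as xor_) (parity-++ (w ∷ bs) (w ∷ cs))))) odd)
  ... | inj₁ odd′ = odd⇒cycle k (≤-pred (≤-trans shorter ≤k)) p₂ odd′
    where
    open ≤-Reasoning
    shorter : length (w ∷ bs) < length (as ++ w ∷ bs ++ w ∷ cs)
    shorter = begin
      suc (length (w ∷ bs))                      ≤⟨ s≤s (m≤m+n _ (length cs)) ⟩
      suc (length (w ∷ bs) + length cs)          ≡⟨ +-suc (length (w ∷ bs)) (length cs) ⟨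
      length (w ∷ bs) + length (w ∷ cs)          ≡⟨ length-++ (w ∷ bs) ⟨
      length (w ∷ bs ++ w ∷ cs)                  ≤⟨ m≤n+m _ (length as) ⟩
      length as + length (w ∷ bs ++ w ∷ cs)      ≡⟨ length-++ as ⟨
      length (as ++ w ∷ bs ++ w ∷ cs)            ∎
  ... | inj₂ odd′ = odd⇒cycle k (≤-pred (≤-trans shorter ≤k)) (walk-++ p₁ p₃)
                      (trans (parity-++ as (w ∷ cs)) odd′)
    where
    open ≤-Reasoning
    shorter : length (as ++ w ∷ cs) < length (as ++ w ∷ bs ++ w ∷ cs)
    shorter = begin
      suc (length (as ++ w ∷ cs))                ≡⟨ cong suc (length-++ as) ⟩
      suc (length as + length (w ∷ cs))          ≡⟨ +-suc (length as) _ ⟨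
      length as + suc (length (w ∷ cs))          ≤⟨ +-monoʳ-≤ (length as) (s≤s (m≤n+m _ (length bs))) ⟩
      length as + suc (length bs + length (w ∷ cs)) ≡⟨ cong (λ k → length as + suc k) (length-++ bs) ⟨
      length as + length (w ∷ bs ++ w ∷ cs)      ≡⟨ length-++ as ⟨
      length (as ++ w ∷ bs ++ w ∷ cs)            ∎

  -- In a tree this forbids two distinct vertices with two common neighbours.
  four-cycle : ∀ {x y z w} → x ≢ y → z ≢ w → x ~ z → y ~ z → x ~ w → y ~ w → Cycle G
  four-cycle {x} {y} {z} {w} x≢y z≢w xz yz xw yw = record
    { start    = x
    ; rest     = z ∷ y ∷ w ∷ []
    ; closed   = xz ∷ ~-sym yz ∷ yw ∷ ~-sym xw ∷ [-]
    ; distinct = (≢ xz ∷ x≢y ∷ ≢ xw ∷ []) ∷ (≢ (~-sym yz) ∷ z≢w ∷ []) ∷ (≢ yw ∷ []) ∷ [] ∷ []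
    ; long     = s≤s (s≤s z≤n)
    }
    where
    ≢ : ∀ {a b} → a ~ b → a ≢ b
    ≢ e eq = ~-irrefl eq e

  -- Bipartition and leaves of a tree

  module _ (tree : IsTree G) where
    open IsTree tree

    -- The class of a vertex is the parity of a chosen walk from the root. An edge inside a class
    -- would close two such walks of equal parity into an odd closed walk, which yields a cycle.
    bipartition : Fin n → ∃[ π ] (∀ {x y} → x ~ y → π x ≡ not (π y))
    bipartition root = π , λ {x} {y} e → ¬-not λ eq → acyclic (odd-walk e eq)
      where
      path : ∀ v → ∃[ xs ] Walk root xs v
      path v = star⇒walk (connected root v)
      π : Fin n → Bool
      π v = parity (proj₁ (path v))
      xor-not : ∀ a → a xor not a ≡ true
      xor-not true  = refl
      xor-not false = refl
      odd-walk : ∀ {x y} → x ~ y → π x ≡ π y → Cycle G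
      odd-walk {x} {y} e eq with ys , q , eq′ ← walk-reverse (proj₂ (path y)) =
        odd⇒cycle _ ≤-refl (walk-++ (proj₂ (path x)) (cons e q))
          (trans (parity-++ (proj₁ (path x)) (x ∷ ys))
            (trans (cong (λ b → π x xor not b) (trans eq′ (sym eq))) (xor-not (π x))))

    -- Connectedness as an induction principle: a set closed under adjacency that contains one
    -- vertex contains all.
    closed⇒all : ∀ {P : Fin n → Set} → (∀ {x y} → x ~ y → P x → P y) → ∀ {u} → P u → ∀ v → P v
    closed⇒all {P} step {u} pu v = go (connected u v) pu
      where
      go : ∀ {x y} → Star _~_ x y → P x → P y
      go ε       px = px
      go (e ◅ p) px = go p (step e px)

    leaf-unique : ∀ {x u v} → Leaf G x → x ~ u → x ~ v → u ≡ v
    leaf-unique {x} leaf xu xv = ∣p∣≡1⇒unique leaf (∈-⟪⟫⁺ (x ~?_) xu) (∈-⟪⟫⁺ (x ~?_) xv)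

    other-neighbour : ∀ {x u} → ¬ Leaf G x → x ~ u → ∃[ v ] x ~ v × v ≢ u
    other-neighbour {x} {u} ¬leaf xu with any? (λ v → (x ~? v) ×-dec ¬? (v ≟ u))
    ... | yes found = found
    ... | no  none  = contradiction (trans (cong ∣_∣ N≡) (∣⁅x⁆∣≡1 u)) ¬leaf
      where
      N≡ : N⟨_⟩ G x ≡ ⁅ u ⁆
      N≡ = ⊆-antisym
        (λ {v} v∈ → subst (_∈ ⁅ u ⁆)
          (sym (decidable-stable (v ≟ u) λ v≢u → none (v , ∈-⟪⟫⁻ (x ~?_) v∈ , v≢u))) (x∈⁅x⁆ u))
        (λ v∈ → subst (_∈ N⟨_⟩ G x) (sym (x∈⁅y⁆⇒x≡y u v∈)) (∈-⟪⟫⁺ (x ~?_) xu))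

    module _ (3≤n : 3 ≤ n) where

      neighbour : ∀ x → ∃[ y ] x ~ y
      neighbour x with z , z≢x , _ ← fresh 3≤n x x with connected x z
      ... | ε     = contradiction refl z≢x
      ... | e ◅ _ = _ , e

      -- Two adjacent leaves would be closed under adjacency and exhaust the tree, but there is a
      -- third vertex.
      leaf≁leaf : ∀ {x y} → Leaf G x → x ~ y → ¬ Leaf G y
      leaf≁leaf {x} {y} lx xy ly with z , z≢x , z≢y ← fresh 3≤n x y
        with closed⇒all {P = λ v → v ≡ x ⊎ v ≡ y}
               (λ { e (inj₁ refl) → inj₂ (leaf-unique lx e xy)
                  ; e (inj₂ refl) → inj₁ (leaf-unique ly e (~-sym xy)) })
               (inj₁ refl) z
      ... | inj₁ z≡x = z≢x z≡x
      ... | inj₂ z≡y = z≢y z≡y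

  -- Separation

  Near : Fin n → Fin n → Set
  Near x z = x ≡ z ⊎ x ~ z

  Near⇒∈N : ∀ {x z} → Near x z → z ∈ N[_] G x
  Near⇒∈N {x} (inj₁ refl) = x∈p∪q⁺ (inj₁ (x∈⁅x⁆ x))
  Near⇒∈N {x} (inj₂ e)    = x∈p∪q⁺ (inj₂ (∈-⟪⟫⁺ (x ~?_) e))

  ∈N⇒Near : ∀ {x z} → z ∈ N[_] G x → Near x z
  ∈N⇒Near {x} z∈ with x∈p∪q⁻ ⁅ x ⁆ (N⟨_⟩ G x) z∈
  ... | inj₁ z∈⁅x⁆ = inj₁ (sym (x∈⁅y⁆⇒x≡y x z∈⁅x⁆))
  ... | inj₂ z∈N   = inj₂ (∈-⟪⟫⁻ (x ~?_) z∈N)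

  -- One inclusion of the equality of traces on `S`. The case analysis refutes the two inclusions
  -- together, applying each where it gives information.
  Below : Subset n → Fin n → Fin n → Set
  Below S x y = ∀ {z} → z ∈ S → Near x z → Near y z

  ≡⇒Below : ∀ {x y} S → N[_] G x ∩ S ≡ N[_] G y ∩ S → Below S x y
  ≡⇒Below S eq z∈S near =
    ∈N⇒Near (proj₁ (x∈p∩q⁻ _ _ (subst (_ ∈_) eq (x∈p∩q⁺ (Near⇒∈N near , z∈S)))))

  separating⁺ : ∀ {c S} → (∀ x y → c x ≢ c y → Below S x y → ¬ Below S y x) → Separating G c S
  separating⁺ {c} {S} sep r b cr cb eq = sep r b
    (λ cr≡cb → red≢blue (trans (sym cr) (trans cr≡cb cb))) (≡⇒Below S eq) (≡⇒Below S (sym eq))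
    where
    red≢blue : red ≢ blue
    red≢blue ()

  -- Each of the two sets bounds `sepRB` from above, so twice `sepRB` is at most the sum of their
  -- sizes.
  halve : ∀ {c} p q → Separating G c (p ∪ q) → Separating G c (∁ p ∪ q) → 2 * sepRB G c ≤ n + ∣ q ∣
  halve {c} p q sep sep′ = begin
    2 * sepRB G c                ≡⟨ cong (sepRB G c +_) (+-identityʳ _) ⟩
    sepRB G c + sepRB G c        ≤⟨ +-mono-≤ (sepRB-minimal G c _ sep) (sepRB-minimal G c _ sep′) ⟩
    ∣ p ∪ q ∣ + ∣ ∁ p ∪ q ∣      ≡⟨ ∣p∪q∣+∣∁p∪q∣≡n+∣q∣ p q ⟩
    n + ∣ q ∣                    ∎
    where open ≤-Reasoning

-- Trees in which every support vertex has a non-leaf neighbour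

module NonStar {n : ℕ} (T : Graph n) (tree : IsTree T) (3≤n : 3 ≤ n)
  (interior : ∀ u → Support T u → ∃[ q ] Graph._~_ T u q × ¬ Leaf T q)
  (π : Fin n → Bool) (proper : ∀ {x y} → Graph._~_ T x y → π x ≡ not (π y))
  (c : Colouring n) where
  open Graph T
  open IsTree tree using (acyclic)

  LeafSame LeafDiff Mixed Moved : Fin n → Set
  LeafSame u = ∃[ l ] (u ~ l × Leaf T l) × c l ≡ c u
  LeafDiff u = ∃[ l ] (u ~ l × Leaf T l) × c l ≢ c u
  Mixed u    = LeafSame u × LeafDiff u
  Moved v    = Leaf T v × ∃[ u ] v ~ u × Mixed u × c v ≡ c u

  mixed? : U.Decidable Mixed
  mixed? u = any? (λ l → ((u ~? l) ×-dec leaf? T l) ×-dec (c l ≟ᶜ c u))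
       ×-dec any? (λ l → ((u ~? l) ×-dec leaf? T l) ×-dec ¬? (c l ≟ᶜ c u))

  moved? : U.Decidable Moved
  moved? v = leaf? T v ×-dec any? λ u → (v ~? u) ×-dec (mixed? u ×-dec (c v ≟ᶜ c u))

  side : Fin n → Bool
  side v = if does (moved? v) then not (π v) else π v

  side-moved : ∀ {v} → Moved v → side v ≡ not (π v)
  side-moved {v} mv rewrite dec-true (moved? v) mv = refl

  side-unmoved : ∀ {v} → ¬ Moved v → side v ≡ π v
  side-unmoved {v} ¬mv rewrite dec-false (moved? v) ¬mv = refl

  -- Such a leaf is moved, and the class opposite to its own is that of its support.
  side-same : ∀ {l u} → Leaf T l → l ~ u → Mixed u → c l ≡ c u → side l ≡ π u
  side-same leaf lu mix eq =
    trans (side-moved (leaf , _ , lu , mix , eq)) (trans (cong not (proper lu)) (not-involutive _))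

  -- A moved leaf has the colour of its only neighbour, so this one stays in place.
  side-diff : ∀ {l u} → Leaf T l → l ~ u → c l ≢ c u → side l ≡ π l
  side-diff leaf lu c≢ = side-unmoved λ { (_ , u′ , lu′ , _ , eq) →
    c≢ (trans eq (cong c (leaf-unique T tree leaf lu′ lu))) }

  side-mono : ∀ {l u} → Leaf T l → l ~ u → ¬ Mixed u → side l ≡ π l
  side-mono leaf lu ¬mix = side-unmoved λ { (_ , u′ , lu′ , mix , _) →
    ¬mix (subst Mixed (leaf-unique T tree leaf lu′ lu) mix) }

  anchor : Fin n → Fin n
  anchor u with mixed? u | support? T u
  ... | yes _ | _     = u
  ... | no  _ | yes s = proj₁ (interior u s)
  ... | no  _ | no  _ = u

  anchors : Subset n
  anchors = image anchor ⟪ support? T ⟫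

  mixed∈anchors : ∀ {u} → Mixed u → u ∈ anchors
  mixed∈anchors {u} mix@((l , (ul , leaf) , _) , _) =
    subst (_∈ anchors) anchor≡ (∈-image⁺ anchor (∈-⟪⟫⁺ (support? T) (l , ul , leaf)))
    where
    anchor≡ : anchor u ≡ u
    anchor≡ with mixed? u | support? T u
    ... | yes _    | _ = refl
    ... | no  ¬mix | _ = contradiction mix ¬mix

  mono-anchor : ∀ {u} → Support T u → ¬ Mixed u → ∃[ q ] u ~ q × ¬ Leaf T q × q ∈ anchors
  mono-anchor {u} sup ¬mix = anchor u , proj₁ edge , proj₂ edge , ∈-image⁺ anchor (∈-⟪⟫⁺ (support? T) sup)
    where
    edge : u ~ anchor u × ¬ Leaf T (anchor u)
    edge with mixed? u | support? T u
    ... | yes mix | _        = contradiction mix ¬mix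
    ... | no  _   | yes s    = proj₂ (interior u s)
    ... | no  _   | no  ¬sup = contradiction sup ¬sup

  -- A vertex v is called active when π v ≡ i, that is, when the unmodified
  -- bipartition class i contains it.
  module _ (i : Bool) (S : Subset n) (side⊆S : ∀ {v} → side v ≡ i → v ∈ S) (anchors⊆S : anchors ⊆ S) where

    active⇒inactive : ∀ {x y} → x ~ y → π y ≡ i → π x ≡ not i
    active⇒inactive xy eq = trans (proper xy) (cong not eq)

    inactive⇒active : ∀ {x y} → x ~ y → π y ≡ not i → π x ≡ i
    inactive⇒active xy eq = trans (proper xy) (trans (cong not eq) (not-involutive i))

    active-nonleaf : ∀ {v} → ¬ Leaf T v → π v ≡ i → v ∈ S
    active-nonleaf ¬leaf eq = side⊆S (trans (side-unmoved λ mv → ¬leaf (proj₁ mv)) eq)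

    -- The leaves of an inactive vertex are active, so an unmoved one suffices. A mixed support has
    -- one of the opposite colour; at any other support no leaf is moved.
    inactive-support⇒leaf∈S : ∀ {y} → Support T y → π y ≡ not i → ∃[ l ] y ~ l × Leaf T l × l ∈ S
    inactive-support⇒leaf∈S {y} (l , yl , leaf) inact with mixed? y
    ... | yes (_ , l′ , (yl′ , leaf′) , c≢) = l′ , yl′ , leaf′ ,
      side⊆S (trans (side-diff leaf′ (~-sym yl′) c≢) (inactive⇒active (~-sym yl′) inact))
    ... | no ¬mix = l , yl , leaf ,
      side⊆S (trans (side-mono leaf (~-sym yl) ¬mix) (inactive⇒active (~-sym yl) inact))

    -- A mixed support is its own anchor. Otherwise `x` is unmoved, hence inactive, and `u` is an
    -- active non-leaf.
    support∈S : ∀ {x u} → Leaf T x → x ~ u → side x ≢ i → u ∈ S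
    support∈S {x} {u} leaf xu side≢ with mixed? u
    ... | yes mix  = anchors⊆S (mixed∈anchors mix)
    ... | no  ¬mix = active-nonleaf (leaf≁leaf T tree 3≤n leaf xu)
      (inactive⇒active (~-sym xu) (¬-not λ eq → side≢ (trans (side-mono leaf xu ¬mix) eq)))

    -- If `y` is a support, one of its leaves in `S` is adjacent to `y` only. If not, any second
    -- neighbour of `y` is an active non-leaf, and it is not adjacent to `w`, which is active too.
    escape : ∀ {y w} → ¬ Leaf T y → π y ≡ not i → y ~ w → ¬ Leaf T w →
             ∃[ z ] z ∈ S × y ~ z × ¬ Near T w z
    escape {y} {w} ¬ly inact yw ¬lw with support? T y
    ... | yes sup with l , yl , leaf , l∈S ← inactive-support⇒leaf∈S sup inact =
      l , l∈S , yl , λ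
        { (inj₁ refl) → ¬lw leaf
        ; (inj₂ wl)   → ~-irrefl (leaf-unique T tree leaf (~-sym yl) (~-sym wl)) yw }
    ... | no ¬sup with z , yz , z≢w ← other-neighbour T tree ¬ly yw =
      z , active-nonleaf (λ leaf → ¬sup (z , yz , leaf)) z-active , yz , λ
        { (inj₁ w≡z) → z≢w (sym w≡z)
        ; (inj₂ wz)  → not-¬ (inactive⇒active (~-sym yw) inact) (active⇒inactive wz z-active) }
      where
      z-active : π z ≡ i
      z-active = inactive⇒active (~-sym yz) inact

    -- The two colours make `u` mixed, so `x` is moved to the class of `u` while `y` stays in the
    -- opposite one: one of them is on side `i`.
    siblings : ∀ {x y u} → Leaf T x → Leaf T y → x ~ u → y ~ u → c x ≡ c u → c y ≢ c u →
               side x ≢ i → ¬ side y ≢ i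
    siblings {x} {y} {u} lx ly xu yu same diff side-x side-y =
      side-y (trans (side-diff ly yu diff) (inactive⇒active yu (¬-not λ eq →
        side-x (trans (side-same lx xu ((x , (~-sym xu , lx) , same) , (y , (~-sym yu , ly) , diff)) same) eq))))

    leaf-off-side : ∀ {x y} → Leaf T x → Leaf T y → c x ≢ c y → Below T S x y → side x ≢ i
    leaf-off-side lx ly c≢ x≲y side≡ with x≲y (side⊆S side≡) (inj₁ refl)
    ... | inj₁ y≡x = c≢ (cong c (sym y≡x))
    ... | inj₂ yx  = leaf≁leaf T tree 3≤n ly yx lx

    -- Neither leaf is on side `i`, so the support of `x` is in `S` and must also be the support of
    -- `y`. Exactly one of the leaves then has its colour, which `siblings` excludes.
    leaf-leaf : ∀ {x y} → Leaf T x → Leaf T y → c x ≢ c y → Below T S x y → ¬ Below T S y x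
    leaf-leaf {x} {y} lx ly c≢ x≲y y≲x with u , xu ← neighbour T tree 3≤n x
      with side-x ← leaf-off-side lx ly c≢ x≲y
         | side-y ← leaf-off-side ly lx (c≢ ∘ sym) y≲x
      with x≲y (support∈S lx xu side-x) (inj₂ xu)
    ... | inj₁ refl = leaf≁leaf T tree 3≤n lx xu ly
    ... | inj₂ yu with c x ≟ᶜ c u
    ...   | yes same = siblings lx ly xu yu same (λ eq → c≢ (trans same (sym eq))) side-x side-y
    ...   | no  diff = siblings ly lx yu xu (≢⇒≡ᶜ diff c≢) diff side-y side-x

    leaf-nonleaf : ∀ {x y} → Leaf T x → ¬ Leaf T y → c x ≢ c y → Below T S x y → ¬ Below T S y x
    leaf-nonleaf {x} {y} lx ¬ly c≢ x≲y y≲x with side x ≟ᵇ i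
    ... | yes side≡ with x≲y (side⊆S side≡) (inj₁ refl)
    ...   | inj₁ refl = ¬ly lx
    -- Now `y` is the support of `x`. If `y` is active, then `x` is inactive and unmoved, hence off
    -- the side. If not, a non-leaf neighbour `q` of `y` is active, so it is in `S`, but it is not
    -- near `x`.
    ...   | inj₂ yx with π y ≟ᵇ i
    ...     | yes act = not-¬ (trans (sym (side-diff lx (~-sym yx) c≢)) side≡) (active⇒inactive (~-sym yx) act)
    ...     | no inact with q , yq , ¬lq ← interior y (x , yx , lx)
      with y≲x (active-nonleaf ¬lq (inactive⇒active (~-sym yq) (¬-not inact))) (inj₂ yq)
    ...       | inj₁ refl = ¬lq lx
    ...       | inj₂ xq   = ~-irrefl (leaf-unique T tree lx (~-sym yx) xq) yq
    -- With `x` off the side, its support `u` is in `S`, so `y` is a neighbour of `u` or `u` itself.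
    leaf-nonleaf {x} {y} lx ¬ly c≢ x≲y y≲x | no side≢ with u , xu ← neighbour T tree 3≤n x
      with x≲y (support∈S lx xu side≢) (inj₂ xu)
    ... | inj₂ yu with π y ≟ᵇ i
    ...   | yes act with y≲x (active-nonleaf ¬ly act) (inj₁ refl)
    ...     | inj₁ refl = ¬ly lx
    ...     | inj₂ xy   = ~-irrefl (leaf-unique T tree lx xy xu) yu
    -- The vertices near `x` are `x` and `u`, both near `u`; `escape` gives a neighbour of `y` in
    -- `S` that is not.
    leaf-nonleaf {x} {y} lx ¬ly c≢ x≲y y≲x | no side≢ | inj₂ yu | no inact
      with z , z∈S , yz , far ← escape ¬ly (¬-not inact) yu (leaf≁leaf T tree 3≤n lx xu)
      with y≲x z∈S (inj₂ yz)
    ...     | inj₁ refl = far (inj₂ (~-sym xu))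
    ...     | inj₂ xz   = far (inj₁ (leaf-unique T tree lx xu xz))
    -- Here `y` is the support of `x`. If it is not mixed, its anchor is a non-leaf neighbour that
    -- `x` does not see.
    leaf-nonleaf {x} {y} lx ¬ly c≢ x≲y y≲x | no side≢ | inj₁ refl with mixed? y
    ... | no ¬mix with q , yq , ¬lq , q∈ ← mono-anchor (x , ~-sym xu , lx) ¬mix
      with y≲x (anchors⊆S q∈) (inj₂ yq)
    ...   | inj₁ refl = ¬lq lx
    ...   | inj₂ xq   = ~-irrefl (leaf-unique T tree lx xu xq) yq
    -- For mixed `y`, inactivity would put the unmoved leaf `x` on the side. If `y` is active, a
    -- leaf `l` of its colour has been moved into `S` and is not near `x`.
    leaf-nonleaf {x} {y} lx ¬ly c≢ x≲y y≲x | no side≢ | inj₁ refl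
        | yes mix@((l , (yl , ll) , same) , _) with π y ≟ᵇ i
    ...   | no inact = side≢ (trans (side-diff lx xu c≢) (inactive⇒active xu (¬-not inact)))
    ...   | yes act with y≲x (side⊆S (trans (side-same ll (~-sym yl) mix same) act)) (inj₂ yl)
    ...     | inj₁ refl = c≢ same
    ...     | inj₂ xl   = leaf≁leaf T tree 3≤n lx xl ll

    -- As `x` is in `S`, the vertex `y` must be an inactive neighbour of `x`, and `escape` gives a
    -- neighbour of `y` in `S` that is not near `x`.
    active-nonleaves : ∀ {x y} → ¬ Leaf T x → ¬ Leaf T y → x ≢ y → π x ≡ i → Below T S x y → ¬ Below T S y x
    active-nonleaves {x} {y} ¬lx ¬ly x≢y act x≲y y≲x
      with x≲y (active-nonleaf ¬lx act) (inj₁ refl)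
    ... | inj₁ y≡x = x≢y (sym y≡x)
    ... | inj₂ yx with z , z∈S , yz , far ← escape ¬ly (active⇒inactive yx act) yx ¬lx =
      far (y≲x z∈S (inj₂ yz))

    -- If `y` is a support, it alone among non-leaves sees its leaf in `S`. If not, all its
    -- neighbours are in `S`; there are at least two, and sharing them with `x` gives a four-cycle.
    inactive-nonleaves : ∀ {x y} → ¬ Leaf T x → ¬ Leaf T y → x ≢ y → π x ≡ not i → π y ≡ not i → ¬ Below T S y x
    inactive-nonleaves {x} {y} ¬lx ¬ly x≢y inx iny y≲x with support? T y
    ... | yes sup with l , yl , ll , l∈S ← inactive-support⇒leaf∈S sup iny
      with y≲x l∈S (inj₂ yl)
    ...   | inj₁ refl = ¬lx ll
    ...   | inj₂ xl   = x≢y (leaf-unique T tree ll (~-sym xl) (~-sym yl))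
    inactive-nonleaves {x} {y} ¬lx ¬ly x≢y inx iny y≲x | no ¬sup
      with z , yz ← neighbour T tree 3≤n y
      with w , yw , w≢z ← other-neighbour T tree ¬ly yz =
      acyclic (four-cycle T x≢y (w≢z ∘ sym) (common yz) yz (common yw) yw)
      where
      common : ∀ {v} → y ~ v → x ~ v
      common {v} yv
        with y≲x (active-nonleaf (λ lv → ¬sup (v , yv , lv)) (inactive⇒active (~-sym yv) iny)) (inj₂ yv)
      ... | inj₁ refl = contradiction inx (not-¬ (inactive⇒active (~-sym yv) iny))
      ... | inj₂ xv   = xv

    -- Colours matter only when a leaf is involved; distinct non-leaves are always told apart.
    S-separating : Separating T c S
    S-separating = separating⁺ T go
      where
      go : ∀ x y → c x ≢ c y → Below T S x y → ¬ Below T S y x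
      go x y c≢ x≲y y≲x with leaf? T x | leaf? T y
      ... | yes lx | yes ly = leaf-leaf lx ly c≢ x≲y y≲x
      ... | yes lx | no ¬ly = leaf-nonleaf lx ¬ly c≢ x≲y y≲x
      ... | no ¬lx | yes ly = leaf-nonleaf ly ¬lx (c≢ ∘ sym) y≲x x≲y
      ... | no ¬lx | no ¬ly with π x ≟ᵇ i | π y ≟ᵇ i
      ...   | yes act | _       = active-nonleaves ¬lx ¬ly (c≢ ∘ cong c) act x≲y y≲x
      ...   | no _    | yes act = active-nonleaves ¬ly ¬lx (c≢ ∘ cong c ∘ sym) act y≲x x≲y
      ...   | no inx  | no iny  = inactive-nonleaves ¬lx ¬ly (c≢ ∘ cong c) (¬-not inx) (¬-not iny) y≲x

  bound : 2 * sepRB T c ≤ n + s T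
  bound = ≤-trans
    (halve T (tabulate side) anchors
      (S-separating true  _ (λ eq → x∈p∪q⁺ (inj₁ (∈-tabulate⁺ side eq))) (x∈p∪q⁺ ∘ inj₂))
      (S-separating false _ (λ eq → x∈p∪q⁺ (inj₁ (∈-∁tabulate⁺ side eq))) (x∈p∪q⁺ ∘ inj₂)))
    (+-monoʳ-≤ n (∣image∣≤∣p∣ anchor ⟪ support? T ⟫))

-- Stars

module CentredStar {n : ℕ} (T : Graph n) (tree : IsTree T) (4≤n : 4 ≤ n)
  (u : Fin n) (support : Support T u) (all-leaves : ∀ {v} → Graph._~_ T u v → Leaf T v)
  (c : Colouring n) where
  open Graph T

  3≤n : 3 ≤ n
  3≤n = ≤-trans (s≤s (s≤s (s≤s z≤n))) 4≤n

  1≤s : 1 ≤ s T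
  1≤s = x∈p⇒1≤∣p∣ (∈-⟪⟫⁺ (support? T) support)

  -- The centre and its neighbours are closed under adjacency, since these neighbours are leaves.
  centre⊎leaf : ∀ v → v ≡ u ⊎ u ~ v
  centre⊎leaf = closed⇒all T tree
    (λ { e (inj₁ refl) → inj₂ e
       ; e (inj₂ uv)   → inj₁ (leaf-unique T tree (all-leaves uv) e (~-sym uv)) })
    (inj₁ refl)

  leaf-near-leaf : ∀ {v w} → u ~ v → u ~ w → Near T v w → v ≡ w
  leaf-near-leaf uv uw (inj₁ v≡w) = v≡w
  leaf-near-leaf uv uw (inj₂ vw)  = contradiction (all-leaves uw) (leaf≁leaf T tree 3≤n (all-leaves uv) vw)

  ≢centre⇒leaf : ∀ {v} → c v ≢ c u → u ~ v
  ≢centre⇒leaf {v} c≢ with centre⊎leaf v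
  ... | inj₁ refl = contradiction refl c≢
  ... | inj₂ uv   = uv

  separating-centre⁺ : ∀ {S} → (∀ x y → c x ≡ c u → c y ≢ c u → Below T S x y → ¬ Below T S y x) →
                       Separating T c S
  separating-centre⁺ {S} sep = separating⁺ T go
    where
    go : ∀ x y → c x ≢ c y → Below T S x y → ¬ Below T S y x
    go x y c≢ x≲y y≲x with c x ≟ᶜ c u
    ... | yes same = sep x y same (λ eq → c≢ (trans same (sym eq))) x≲y y≲x
    ... | no  diff = sep y x (≢⇒≡ᶜ diff c≢) diff y≲x x≲y

  -- The anchor `e` tells the centre from every leaf of the other colour. Two leaves of different
  -- colours are told apart by whichever of them lies in the chosen colour class.
  bound-with-anchor : ∀ e → u ~ e → c e ≡ c u → 2 * sepRB T c ≤ n + s T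
  bound-with-anchor e ue same = ≤-trans
    (halve T (tabulate likeCentre) ⁅ e ⁆ (separating-centre⁺ sep) (separating-centre⁺ sep′))
    (+-monoʳ-≤ n (≤-trans (≤-reflexive (∣⁅x⁆∣≡1 e)) 1≤s))
    where
    likeCentre : Fin n → Bool
    likeCentre v = does (c v ≟ᶜ c u)
    e-far : ∀ {y} → c y ≢ c u → ¬ Near T y e
    e-far diff near = diff (trans (cong c (leaf-near-leaf (≢centre⇒leaf diff) ue near)) same)
    sep : ∀ x y → c x ≡ c u → c y ≢ c u →
          Below T (tabulate likeCentre ∪ ⁅ e ⁆) x y → ¬ Below T (tabulate likeCentre ∪ ⁅ e ⁆) y x
    sep x y cx cy x≲y _
      with x≲y (x∈p∪q⁺ (inj₁ (∈-tabulate⁺ likeCentre (dec-true (c x ≟ᶜ c u) cx)))) (inj₁ refl) | centre⊎leaf x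
    ... | _    | inj₁ refl = e-far cy (x≲y (x∈p∪q⁺ (inj₂ (x∈⁅x⁆ e))) (inj₂ ue))
    ... | near | inj₂ ux   = cy (trans (cong c (leaf-near-leaf (≢centre⇒leaf cy) ux near)) cx)
    sep′ : ∀ x y → c x ≡ c u → c y ≢ c u →
           Below T (∁ (tabulate likeCentre) ∪ ⁅ e ⁆) x y → ¬ Below T (∁ (tabulate likeCentre) ∪ ⁅ e ⁆) y x
    sep′ x y cx cy x≲y y≲x
      with y≲x (x∈p∪q⁺ (inj₁ (∈-∁tabulate⁺ likeCentre (dec-false (c y ≟ᶜ c u) cy)))) (inj₁ refl) | centre⊎leaf x
    ... | _    | inj₁ refl = e-far cy (x≲y (x∈p∪q⁺ (inj₂ (x∈⁅x⁆ e))) (inj₂ ue))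
    ... | near | inj₂ ux   = cy (trans (cong c (sym (leaf-near-leaf ux (≢centre⇒leaf cy) near))) cx)

  -- Only the centre has its colour. It sees both `a` and `b`, while a leaf sees at most one of
  -- them; four is at most `n`.
  bound-without-anchor : (∀ {v} → u ~ v → c v ≢ c u) → 2 * sepRB T c ≤ n + s T
  bound-without-anchor diff with a , ua ← neighbour T tree 3≤n u
    with b , ub , b≢a ← other-neighbour T tree (leaf≁leaf T tree 3≤n (all-leaves ua) (~-sym ua)) ua = begin
      2 * sepRB T c  ≤⟨ *-monoʳ-≤ 2 ≤2 ⟩
      4              ≤⟨ 4≤n ⟩
      n              ≤⟨ m≤m+n n (s T) ⟩
      n + s T        ∎
    where
    open ≤-Reasoning
    sep : ∀ x y → c x ≡ c u → c y ≢ c u → Below T (⁅ a ⁆ ∪ ⁅ b ⁆) x y → ¬ Below T (⁅ a ⁆ ∪ ⁅ b ⁆) y x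
    sep x y cx cy x≲y _ with centre⊎leaf x
    ... | inj₂ ux   = diff ux cx
    ... | inj₁ refl = b≢a (trans
      (sym (leaf-near-leaf (≢centre⇒leaf cy) ub (x≲y (x∈p∪q⁺ (inj₂ (x∈⁅x⁆ b))) (inj₂ ub))))
      (leaf-near-leaf (≢centre⇒leaf cy) ua (x≲y (x∈p∪q⁺ (inj₁ (x∈⁅x⁆ a))) (inj₂ ua))))
    ≤2 : sepRB T c ≤ 2
    ≤2 = begin
      sepRB T c              ≤⟨ sepRB-minimal T c _ (separating-centre⁺ sep) ⟩
      ∣ ⁅ a ⁆ ∪ ⁅ b ⁆ ∣      ≤⟨ ∣p∪q∣≤∣p∣+∣q∣ ⁅ a ⁆ ⁅ b ⁆ ⟩
      ∣ ⁅ a ⁆ ∣ + ∣ ⁅ b ⁆ ∣  ≡⟨ cong₂ _+_ (∣⁅x⁆∣≡1 a) (∣⁅x⁆∣≡1 b) ⟩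
      2                      ∎

  bound : 2 * sepRB T c ≤ n + s T
  bound with any? (λ e → (u ~? e) ×-dec (c e ≟ᶜ c u))
  ... | yes (e , ue , same) = bound-with-anchor e ue same
  ... | no  none            = bound-without-anchor λ uv eq → none (_ , uv , eq)

-- The bound for all trees

sepRB-bound : ∀ {n : ℕ} (T : Graph n) → IsTree T → 5 ≤ n → ∀ c → 2 * sepRB T c ≤ n + s T
-- Matching on `s≤s` exposes `n` as a successor, so that `zero` can serve as the root of the
-- bipartition.
sepRB-bound T tree 5≤n@(s≤s _) c with any? centre?
  where
  open Graph T
  centre? : U.Decidable λ u → Support T u × ¬ (∃[ q ] u ~ q × ¬ Leaf T q)
  centre? u = support? T u ×-dec ¬? (any? λ q → (u ~? q) ×-dec ¬? (leaf? T q))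
-- A support all of whose neighbours are leaves is the centre of a star.
... | yes (u , sup , none) =
  CentredStar.bound T tree (≤-trans (s≤s (s≤s (s≤s (s≤s z≤n)))) 5≤n) u sup
    (λ {v} uv → decidable-stable (leaf? T v) λ ¬lv → none (v , uv , ¬lv)) c
... | no none with π , proper ← bipartition T tree zero =
  NonStar.bound T tree (≤-trans (s≤s (s≤s (s≤s z≤n))) 5≤n)
    (λ u sup → decidable-stable (any? λ q → (Graph._~?_ T u q) ×-dec ¬? (leaf? T q)) λ no-q → none (u , sup , no-q))
    π proper c

theorem17 : ∀ {n : ℕ} (T : Graph n) → IsTree T → 5 ≤ n → 2 * maxSepRB T ≤ n + s T
theorem17 {n} T tree 5≤n with c , eq ← maxSepRB-attained T =
  subst (λ k → 2 * k ≤ n + s T) eq (sepRB-bound T tree 5≤n c)
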